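{- Let $(H,\star)$ be a group, $K$ a nonempty set and $\theta:K\to H$ a map. Define four products on $H\times K$ by, for all $(\alpha,\alpha'),(\beta,\beta')\in H\times K$: $$(\alpha,\alpha')\leftarrow(\beta,\beta')=(\alpha,\alpha'),\quad(\alpha,\alpha')\rightarrow(\beta,\beta')=(\beta,\beta'),$$ $$(\alpha,\alpha')\triangleleft(\beta,\beta')=(\alpha^{ -1}\star\beta,\beta'),\quad(\alpha,\alpha')\triangleright(\beta,\beta')=(\theta(\beta')\star\beta^{ -1}\star\alpha,\alpha').$$ This defines a nondegenerate extended diassociative semigroup (EDS), denoted $\mathbf{EDS}^*(H,\star,K,\theta)$. It is commutative if, and only if, for any $\alpha'\in K$, $\theta(\alpha')$ is the unit of $H$. Moreover, for all $(\alpha,\alpha'),(\beta,\beta')\in H\times K$: $$(\alpha,\alpha')\curvearrowleft(\beta,\beta')=(\alpha,\alpha'),\quad(\alpha,\alpha')\blacktriangleleft(\beta,\beta')=(\alpha\star\beta,\beta'),$$ $$(\alpha,\alpha')\curvearrowright(\beta,\beta')=(\beta,\beta'),\quad(\alpha,\alpha')\blacktriangleright(\beta,\beta')=(\beta\star\theta(\beta')^{ -1}\star\alpha,\alpha').$$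
   Context: Extended diassociative semigroups. A diassociative semigroup is a set $\Omega$ with maps $\leftarrow,\rightarrow:\Omega\times\Omega\to\Omega$ such that for all $\alpha,\beta,\gamma\in\Omega$: $(\alpha\leftarrow\beta)\leftarrow\gamma=\alpha\leftarrow(\beta\leftarrow\gamma)=\alpha\leftarrow(\beta\rightarrow\gamma)$; $(\alpha\rightarrow\beta)\leftarrow\gamma=\alpha\rightarrow(\beta\leftarrow\gamma)$; $(\alpha\rightarrow\beta)\rightarrow\gamma=(\alpha\leftarrow\beta)\rightarrow\gamma=\alpha\rightarrow(\beta\rightarrow\gamma)$. An extended diassociative semigroup (EDS) is $(\Omega,\leftarrow,\rightarrow,\triangleleft,\triangleright)$ such that $(\Omega,\leftarrow,\rightarrow)$ is a diassociative semigroup and for all $\alpha,\beta,\gamma\in\Omega$: $\alpha\triangleright(\beta\leftarrow\gamma)=\alpha\triangleright\beta$; $(\alpha\rightarrow\beta)\triangleleft\gamma=\beta\triangleleft\gamma$; $(\alpha\triangleleft\beta)\leftarrow((\alpha\leftarrow\beta)\triangleleft\gamma)=\alpha\triangleleft(\beta\leftarrow\gamma)$; $(\alpha\triangleleft\beta)\triangleleft((\alpha\leftarrow\beta)\triangleleft\gamma)=\beta\triangleleft\gamma$; $(\alpha\triangleleft\beta)\rightarrow((\alpha\leftarrow\beta)\triangleleft\gamma)=\alpha\triangleleft(\beta\rightarrow\gamma)$; $(\alpha\triangleleft\beta)\triangleright((\alpha\leftarrow\beta)\triangleleft\gamma)=\beta\triangleright\gamma$; $(\alpha\triangleright(\beta\rightarrow\gamma))\leftarrow(\beta\triangleright\gamma)=(\alpha\leftarrow\beta)\triangleright\gamma$;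 $(\alpha\triangleright(\beta\rightarrow\gamma))\triangleleft(\beta\triangleright\gamma)=\alpha\triangleleft\beta$; $(\alpha\triangleright(\beta\rightarrow\gamma))\rightarrow(\beta\triangleright\gamma)=(\alpha\rightarrow\beta)\triangleright\gamma$; $(\alpha\triangleright(\beta\rightarrow\gamma))\triangleright(\beta\triangleright\gamma)=\alpha\triangleright\beta$. It is commutative if $\alpha\rightarrow\beta=\beta\leftarrow\alpha$ and $\alpha\triangleright\beta=\beta\triangleleft\alpha$ for all $\alpha,\beta$. It is nondegenerate if the maps $\varphi_\leftarrow:(\alpha,\beta)\mapsto(\alpha\leftarrow\beta,\alpha\triangleleft\beta)$ and $\varphi_\rightarrow:(\alpha,\beta)\mapsto(\alpha\rightarrow\beta,\alpha\triangleright\beta)$ from $\Omega^2$ to $\Omega^2$ are bijective. For a nondegenerate EDS $\Omega$, the operations $\curvearrowleft,\blacktriangleleft,\curvearrowright,\blacktriangleright$ on $\Omega$ are defined by $\varphi_\leftarrow^{ -1}(\alpha,\beta)=(\alpha\curvearrowleft\beta,\alpha\blacktriangleleft\beta)$ and $\varphi_\rightarrow^{ -1}(\alpha,\beta)=(\beta\blacktriangleright\alpha,\beta\curvearrowright\alpha)$. -}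

module Defs where

open import Level using (Level; _⊔_; suc)
open import Algebra.Bundles using (Group)
open import Algebra.Core using (Op₂)
open import Algebra.Definitions using (Congruent₂)
open import Data.Product using (_×_; _,_; proj₁; proj₂)
open import Data.Product.Relation.Binary.Pointwise.NonDependent using (Pointwise; ×-setoid)
open import Function.Bundles using (Func)
open import Function.Definitions using (Bijective)
open import Relation.Binary.Bundles using (Setoid)
open import Relation.Binary.Core using (Rel)
open import Relation.Binary.Structures using (IsEquivalence)

private variable
  c ℓ k ℓ′ : Level

-- As in Algebra.Bundles, sets are setoids and operations respect the equality.
-- The arrows are written ⟵ and ⟶ because → is reserved.

record RawEDS c ℓ : Set (suc (c ⊔ ℓ)) where
  infix  4 _≈_
  infixl 7 _⟵_ _⟶_ _◁_ _▷_
  field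
    Carrier : Set c
    _≈_     : Rel Carrier ℓ
    _⟵_     : Op₂ Carrier
    _⟶_     : Op₂ Carrier
    _◁_     : Op₂ Carrier
    _▷_     : Op₂ Carrier

  infix 4 _≈²_
  _≈²_ : Rel (Carrier × Carrier) ℓ
  _≈²_ = Pointwise _≈_ _≈_

  φ⟵ : Carrier × Carrier → Carrier × Carrier
  φ⟵ (α , β) = α ⟵ β , α ◁ β

  φ⟶ : Carrier × Carrier → Carrier × Carrier
  φ⟶ (α , β) = α ⟶ β , α ▷ β

record IsDiassociativeSemigroup {A : Set c} (_≈_ : Rel A ℓ) (_⟵_ _⟶_ : Op₂ A)
       : Set (c ⊔ ℓ) where
  field
    isEquivalence : IsEquivalence _≈_
    ⟵-cong : Congruent₂ _≈_ _⟵_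
    ⟶-cong : Congruent₂ _≈_ _⟶_
    ⟵-assoc     : ∀ α β γ → ((α ⟵ β) ⟵ γ) ≈ (α ⟵ (β ⟵ γ))
    ⟵-absorbs-⟶ : ∀ α β γ → (α ⟵ (β ⟵ γ)) ≈ (α ⟵ (β ⟶ γ))
    ⟶-⟵-assoc   : ∀ α β γ → ((α ⟶ β) ⟵ γ) ≈ (α ⟶ (β ⟵ γ))
    ⟶-absorbs-⟵ : ∀ α β γ → ((α ⟶ β) ⟶ γ) ≈ ((α ⟵ β) ⟶ γ)
    ⟶-assoc     : ∀ α β γ → ((α ⟵ β) ⟶ γ) ≈ (α ⟶ (β ⟶ γ))

record IsEDS (Ω : RawEDS c ℓ) : Set (c ⊔ ℓ) where
  open RawEDS Ω
  field
    isDiassociativeSemigroup : IsDiassociativeSemigroup _≈_ _⟵_ _⟶_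
    ◁-cong : Congruent₂ _≈_ _◁_
    ▷-cong : Congruent₂ _≈_ _▷_
    ▷-⟵   : ∀ α β γ → α ▷ (β ⟵ γ) ≈ α ▷ β
    ⟶-◁   : ∀ α β γ → (α ⟶ β) ◁ γ ≈ β ◁ γ
    ◁-⟵-◁ : ∀ α β γ → (α ◁ β) ⟵ ((α ⟵ β) ◁ γ) ≈ α ◁ (β ⟵ γ)
    ◁-◁-◁ : ∀ α β γ → (α ◁ β) ◁ ((α ⟵ β) ◁ γ) ≈ β ◁ γ
    ◁-⟶-◁ : ∀ α β γ → (α ◁ β) ⟶ ((α ⟵ β) ◁ γ) ≈ α ◁ (β ⟶ γ)
    ◁-▷-◁ : ∀ α β γ → (α ◁ β) ▷ ((α ⟵ β) ◁ γ) ≈ β ▷ γ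
    ▷-⟵-▷ : ∀ α β γ → (α ▷ (β ⟶ γ)) ⟵ (β ▷ γ) ≈ (α ⟵ β) ▷ γ
    ▷-◁-▷ : ∀ α β γ → (α ▷ (β ⟶ γ)) ◁ (β ▷ γ) ≈ α ◁ β
    ▷-⟶-▷ : ∀ α β γ → (α ▷ (β ⟶ γ)) ⟶ (β ▷ γ) ≈ (α ⟶ β) ▷ γ
    ▷-▷-▷ : ∀ α β γ → (α ▷ (β ⟶ γ)) ▷ (β ▷ γ) ≈ α ▷ β

record IsCommutative (Ω : RawEDS c ℓ) : Set (c ⊔ ℓ) where
  open RawEDS Ω
  field
    ⟶-⟵-comm : ∀ α β → α ⟶ β ≈ β ⟵ α
    ▷-◁-comm : ∀ α β → α ▷ β ≈ β ◁ α

record IsNondegenerateEDS (Ω : RawEDS c ℓ) : Set (c ⊔ ℓ) where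
  open RawEDS Ω
  field
    isEDS        : IsEDS Ω
    φ⟵-bijective : Bijective _≈²_ _≈²_ φ⟵
    φ⟶-bijective : Bijective _≈²_ _≈²_ φ⟶

  -- The preimages supplied by surjectivity; by injectivity they are unique up to _≈²_.
  φ⟵⁻¹ : Carrier × Carrier → Carrier × Carrier
  φ⟵⁻¹ p = proj₁ (proj₂ φ⟵-bijective p)

  φ⟶⁻¹ : Carrier × Carrier → Carrier × Carrier
  φ⟶⁻¹ p = proj₁ (proj₂ φ⟶-bijective p)

  infixl 7 _↶_ _◀_ _↷_ _▶_

  _↶_ : Op₂ Carrier
  α ↶ β = proj₁ (φ⟵⁻¹ (α , β))

  _◀_ : Op₂ Carrier
  α ◀ β = proj₂ (φ⟵⁻¹ (α , β))

  -- The arguments are exchanged here: φ⟶⁻¹ (α , β) = (β ▶ α , β ↷ α).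
  _↷_ : Op₂ Carrier
  α ↷ β = proj₂ (φ⟶⁻¹ (β , α))

  _▶_ : Op₂ Carrier
  α ▶ β = proj₁ (φ⟶⁻¹ (β , α))

EDS* : (H : Group c ℓ) (K : Setoid k ℓ′) → Func K (Group.setoid H) →
       RawEDS (c ⊔ k) (ℓ ⊔ ℓ′)
EDS* H K θ = record
  { Carrier = Setoid.Carrier H×K
  ; _≈_     = Setoid._≈_ H×K
  ; _⟵_     = λ (α , α′) (β , β′) → α , α′
  ; _⟶_     = λ (α , α′) (β , β′) → β , β′
  ; _◁_     = λ (α , α′) (β , β′) → (α ⁻¹) ∙ β , β′
  ; _▷_     = λ (α , α′) (β , β′) → (θ.to β′ ∙ (β ⁻¹)) ∙ α , α′
  }
  where
  open Group H using (_∙_; _⁻¹; setoid)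
  module θ = Func θ
  H×K = ×-setoid setoid K

module Submission where

open import Algebra.Bundles using (Group)
open import Data.Product using (_×_; _,_; proj₁; Σ-syntax)
open import Data.Product.Relation.Binary.Pointwise.NonDependent using (×-setoid)
open import Function.Bundles using (Func; _⇔_; mk⇔)
open import Function.Definitions using (Bijective)
open import Relation.Binary.Bundles using (Setoid)
import Algebra.Properties.Group as GroupProperties
import Relation.Binary.Reasoning.Setoid as ≈-Reasoning
open import Defs

-- Both arrows are projections, so every axiom whose outermost product is an arrow holds by
-- computation. On `H`, `◁` is the left division of `b` by `a`, and `▷` is such a division
-- multiplied on the left by a value of `θ`. The four axioms that remain nest one division in
-- another; they hold because left division does not change when both arguments are multiplied on
-- the left by the same element. Nondegeneracy: the first component of `φ⟵` or `φ⟶` reveals one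
-- argument, and the other is recovered because left translations of a group are invertible. Solving
-- for it gives the stated inverse formulas. Commutativity compares `α ▷ β` with `β ◁ α`, which
-- differ exactly by the left factor `θ⟨ β′ ⟩`.

module _ {c ℓ} (H : Group c ℓ) where
  open Group H
  open GroupProperties H

  \\-translate : ∀ x y z → (x ∙ y) \\ (x ∙ z) ≈ y \\ z
  \\-translate x y z = begin
    (x ∙ y) ⁻¹ ∙ (x ∙ z)     ≈⟨ ∙-congʳ (⁻¹-anti-homo-∙ x y) ⟩
    (y ⁻¹ ∙ x ⁻¹) ∙ (x ∙ z)  ≈⟨ assoc _ _ _ ⟩
    y ⁻¹ ∙ (x ⁻¹ ∙ (x ∙ z))  ≈⟨ ∙-congˡ (\\-leftDividesʳ x z) ⟩
    y ⁻¹ ∙ z                 ∎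
    where open ≈-Reasoning setoid

  ∙-\\-translate : ∀ t x y z → (t ∙ (x ∙ y) ⁻¹) ∙ (x ∙ z) ≈ (t ∙ y ⁻¹) ∙ z
  ∙-\\-translate t x y z = begin
    (t ∙ (x ∙ y) ⁻¹) ∙ (x ∙ z)  ≈⟨ assoc _ _ _ ⟩
    t ∙ ((x ∙ y) ⁻¹ ∙ (x ∙ z))  ≈⟨ ∙-congˡ (\\-translate x y z) ⟩
    t ∙ (y ⁻¹ ∙ z)              ≈⟨ assoc _ _ _ ⟨
    (t ∙ y ⁻¹) ∙ z              ∎
    where open ≈-Reasoning setoid

  -- The two quotients are inverse to each other. With `x` a value of `θ`, this checks the preimage
  -- chosen for `φ⟶`.
  //-∙-cancel : ∀ x y z → (x // y) ∙ ((y // x) ∙ z) ≈ z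
  //-∙-cancel x y z = begin
    (x // y) ∙ ((y // x) ∙ z)     ≈⟨ ∙-congˡ (∙-congʳ (⁻¹-anti-homo-// x y)) ⟨
    (x // y) ∙ ((x // y) ⁻¹ ∙ z)  ≈⟨ \\-leftDividesˡ (x // y) z ⟩
    z                             ∎
    where open ≈-Reasoning setoid

module _ {c ℓ k ℓ′} (H : Group c ℓ) (K : Setoid k ℓ′) (θ : Func K (Group.setoid H)) where
  open Group H using (_∙_; _⁻¹; _//_; ε; sym; trans; ∙-cong; ∙-congʳ; ⁻¹-cong; identityˡ)
    renaming (_≈_ to _≈ᴴ_)
  open GroupProperties H
  open Func θ using () renaming (to to θ⟨_⟩; cong to θ-cong)
  open RawEDS (EDS* H K θ)
  private
    module K = Setoid K
    module H×K = Setoid (×-setoid (Group.setoid H) K)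

  EDS*-isEDS : IsEDS (EDS* H K θ)
  EDS*-isEDS = record
    { isDiassociativeSemigroup = record
      { isEquivalence = H×K.isEquivalence
      ; ⟵-cong        = λ α≈ _ → α≈
      ; ⟶-cong        = λ _ β≈ → β≈
      ; ⟵-assoc       = λ _ _ _ → H×K.refl
      ; ⟵-absorbs-⟶   = λ _ _ _ → H×K.refl
      ; ⟶-⟵-assoc     = λ _ _ _ → H×K.refl
      ; ⟶-absorbs-⟵   = λ _ _ _ → H×K.refl
      ; ⟶-assoc       = λ _ _ _ → H×K.refl
      }
    ; ◁-cong = λ (a≈ , _) (b≈ , b′≈) → \\-cong₂ a≈ b≈ , b′≈
    ; ▷-cong = λ (a≈ , a′≈) (b≈ , b′≈) →
        ∙-cong (//-cong₂ (θ-cong b′≈) b≈) a≈ , a′≈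
    ; ▷-⟵   = λ _ _ _ → H×K.refl
    ; ⟶-◁   = λ _ _ _ → H×K.refl
    ; ◁-⟵-◁ = λ _ _ _ → H×K.refl
    -- The common left factor is `a ⁻¹` in the two axioms built on `◁`, and `θ⟨ c′ ⟩ ∙ c ⁻¹` in the
    -- two built on `▷`.
    ; ◁-◁-◁ = λ (a , _) (b , _) (c , _) → \\-translate H (a ⁻¹) b c , K.refl
    ; ◁-⟶-◁ = λ _ _ _ → H×K.refl
    ; ◁-▷-◁ = λ (a , _) (b , _) (c , c′) → ∙-\\-translate H θ⟨ c′ ⟩ (a ⁻¹) c b , K.refl
    ; ▷-⟵-▷ = λ _ _ _ → H×K.refl
    ; ▷-◁-▷ = λ (a , _) (b , _) (c , c′) → \\-translate H (θ⟨ c′ ⟩ ∙ c ⁻¹) a b , K.refl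
    ; ▷-⟶-▷ = λ _ _ _ → H×K.refl
    -- The outer `θ` is taken at `b′`, the `K`-component of `β ▷ γ`.
    ; ▷-▷-▷ = λ (a , _) (b , b′) (c , c′) →
        ∙-\\-translate H θ⟨ b′ ⟩ (θ⟨ c′ ⟩ ∙ c ⁻¹) b a , K.refl
    }

  EDS*-φ⟵-bijective : Bijective _≈²_ _≈²_ φ⟵
  EDS*-φ⟵-bijective =
    (λ { {(a , _) , (b , _)} {(c , _) , (d , _)} (α≈@(a≈c , _) , (a\\b≈c\\d , b′≈d′)) →
      -- Since `a ≈ c` is known, both sides are translates by `a ⁻¹`, which cancels.
      α≈ , (∙-cancelˡ (a ⁻¹) b d (trans a\\b≈c\\d (∙-congʳ (⁻¹-cong (sym a≈c)))) , b′≈d′) }) ,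
    (λ ((a , a′) , (b , b′)) → ((a , a′) , (a ∙ b , b′)) ,
      λ { (α≈@(a≈ , _) , (b≈ , b′≈)) →
        α≈ , (trans (\\-cong₂ a≈ b≈) (\\-leftDividesʳ a b) , b′≈) })

  EDS*-φ⟶-bijective : Bijective _≈²_ _≈²_ φ⟶
  EDS*-φ⟶-bijective =
    (λ { {(a , _) , (b , b′)} {(c , _) , (d , d′)} (β≈@(b≈d , b′≈d′) , (▷≈ , a′≈c′)) →
      (∙-cancelˡ (θ⟨ b′ ⟩ // b) a c
        (trans ▷≈ (∙-congʳ (sym (//-cong₂ (θ-cong b′≈d′) b≈d)))) , a′≈c′) , β≈ }) ,
    -- The target's first entry is the second argument of the preimage; the other comes from solving
    -- `(θ⟨ a′ ⟩ ∙ a ⁻¹) ∙ x ≈ b` for `x`.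
    (λ ((a , a′) , (b , b′)) → (((a // θ⟨ a′ ⟩) ∙ b , b′) , (a , a′)) ,
      λ { ((x≈ , x′≈) , α≈@(a≈ , a′≈)) →
        α≈ , (trans (∙-cong (//-cong₂ (θ-cong a′≈) a≈) x≈) (//-∙-cancel H θ⟨ a′ ⟩ a b) , x′≈) })

  EDS*-isNondegenerate : IsNondegenerateEDS (EDS* H K θ)
  EDS*-isNondegenerate = record
    { isEDS        = EDS*-isEDS
    ; φ⟵-bijective = EDS*-φ⟵-bijective
    ; φ⟶-bijective = EDS*-φ⟶-bijective
    }

  EDS*-commutative⇔θ-trivial : IsCommutative (EDS* H K θ) ⇔ (∀ α′ → θ⟨ α′ ⟩ ≈ᴴ ε)
  EDS*-commutative⇔θ-trivial = mk⇔
    -- Testing at `H`-component `ε` on both sides leaves `θ⟨ α′ ⟩ ∙ ε ⁻¹ ≈ ε ⁻¹` after cancelling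
    -- the right factor.
    (λ comm α′ → identityˡ-unique _ _ (∙-cancelʳ _ _ _
      (proj₁ (IsCommutative.▷-◁-comm comm (ε , α′) (ε , α′)))))
    (λ θ≈ε → record
      { ⟶-⟵-comm = λ _ _ → H×K.refl
      ; ▷-◁-comm = λ _ (_ , β′) → ∙-congʳ (trans (∙-congʳ (θ≈ε β′)) (identityˡ _)) , K.refl
      })

proposition9 : ∀ {c ℓ k ℓ′} (H : Group c ℓ) (K : Setoid k ℓ′) → Setoid.Carrier K →
  (θ : Func K (Group.setoid H)) →
  let open Group H renaming (_≈_ to _≈ᴴ_)
      open Func θ using () renaming (to to θ⟨_⟩)
      open RawEDS (EDS* H K θ) using (_≈_)
  in
  Σ[ isNondegenerateEDS ∈ IsNondegenerateEDS (EDS* H K θ) ]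
    (let open IsNondegenerateEDS isNondegenerateEDS in
     (IsCommutative (EDS* H K θ) ⇔ (∀ α′ → θ⟨ α′ ⟩ ≈ᴴ ε)) ×
     (∀ α α′ β β′ →
       ((α , α′) ↶ (β , β′) ≈ (α , α′)) ×
       ((α , α′) ◀ (β , β′) ≈ (α ∙ β , β′)) ×
       ((α , α′) ↷ (β , β′) ≈ (β , β′)) ×
       ((α , α′) ▶ (β , β′) ≈ ((β ∙ (θ⟨ β′ ⟩ ⁻¹)) ∙ α , α′))))
proposition9 H K _ θ =
  EDS*-isNondegenerate H K θ ,
  EDS*-commutative⇔θ-trivial H K θ ,
  -- The inverse operations are components of the explicit surjectivity witnesses, so each formula
  -- holds by computation.
  λ _ _ _ _ → refl , refl , refl , refl
  where open Setoid (×-setoid (Group.setoid H) K) using (refl)
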